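{- Let $\Gamma$ be a highly-regular graph with $3\le\operatorname{diam}(\Gamma)<\infty$. Then the complement $\overline{\Gamma}$ is a highly-regular graph with $\operatorname{diam}(\overline{\Gamma})=2$ which is not distance-regular.
   Context: All graphs are finite, undirected, without loops or multiple edges; the diameter of a disconnected graph is $\infty$. $\overline{\Gamma}$ has vertex set $V(\Gamma)$ and edges exactly the pairs of distinct vertices not adjacent in $\Gamma$. A graph $\Gamma$ of order $n$ is highly-regular with collapsed adjacency matrix (CAM) $C=[c_{i,j}]_{1\le i,j\le m}$, where $2\le m<n$ (the value $m=n$ is allowed only when $n=2$), if for every vertex $u$ there is a partition of $V(\Gamma)$ into nonempty sets $V_1(u)=\{u\},V_2(u),\dots,V_m(u)$ such that for all $i,j$, every vertex $y\in V_j(u)$ is adjacent to exactly $c_{i,j}$ vertices of $V_i(u)$. A connected graph $\Gamma$ is distance-regular if for all $u,v$ the numbers $|D_1(v)\cap D_{i-1}(u)|$, $|D_1(v)\cap D_i(u)|$, $|D_1(v)\cap D_{i+1}(u)|$ depend only on $i=d(u,v)$, where $D_i(u)=\{v:d(u,v)=i\}$. -}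

module Defs where

open import Data.Fin using (Fin; zero)
open import Data.Fin.Properties using (_≟_; any?)
open import Data.Fin.Subset using (Subset; _∈_; _∩_; ⊥; ⁅_⁆; ∣_∣; Nonempty)
open import Data.Nat using (ℕ; zero; suc; _≤_; _<_)
open import Data.Nat.Properties using (allUpTo?)
open import Data.Product using (_×_; _,_; ∃-syntax)
open import Data.Sum using (_⊎_)
open import Data.Vec using (tabulate)
open import Function using (_∘_)
open import Relation.Binary.Definitions using (Decidable)
open import Relation.Binary.PropositionalEquality using (_≡_; _≢_; refl; sym)
open import Relation.Nullary using (¬_; does)
open import Relation.Nullary.Decidable using (_×-dec_; ¬?)
import Relation.Unary as U

record Graph (n : ℕ) : Set₁ where
  field
    Adj    : Fin n → Fin n → Set
    adj?   : Decidable Adj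
    symm   : ∀ {u v} → Adj u v → Adj v u
    irrefl : ∀ {u} → ¬ Adj u u

complement : ∀ {n} → Graph n → Graph n
complement Γ = record
  { Adj    = λ u v → u ≢ v × ¬ Adj u v
  ; adj?   = λ u v → ¬? (u ≟ v) ×-dec ¬? (adj? u v)
  ; symm   = λ (u≢v , ¬uv) → (u≢v ∘ sym) , (¬uv ∘ symm)
  ; irrefl = λ (u≢u , _) → u≢u refl
  }
  where open Graph Γ

subset : ∀ {n} {P : Fin n → Set} → U.Decidable P → Subset n
subset P? = tabulate (does ∘ P?)

module _ {n : ℕ} (Γ : Graph n) where
  open Graph Γ

  neighbours : Fin n → Subset n
  neighbours y = subset (adj? y)

  Walk : ℕ → Fin n → Fin n → Set
  Walk zero    u v = u ≡ v
  Walk (suc k) u v = ∃[ w ] (Adj u w × Walk k w v)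

  walk? : ∀ k → Decidable (Walk k)
  walk? zero    u v = u ≟ v
  walk? (suc k) u v = any? λ w → adj? u w ×-dec walk? k w v

  -- Distance i u v means d(u,v) = i; when u and v lie in different
  -- components it holds for no i, i.e. d(u,v) = ∞.
  Distance : ℕ → Fin n → Fin n → Set
  Distance i u v = Walk i u v × (∀ {j} → j < i → ¬ Walk j u v)

  distance? : ∀ i → Decidable (Distance i)
  distance? i u v = walk? i u v ×-dec allUpTo? (λ j → ¬? (walk? j u v)) i

  Connected : Set
  Connected = ∀ u v → ∃[ k ] Walk k u v

  -- HasDiameter d means diam(Γ) = d with d finite; it holds for no d when
  -- Γ is disconnected, i.e. when diam(Γ) = ∞.
  HasDiameter : ℕ → Set
  HasDiameter d =
    (∀ u v → ∃[ i ] (i ≤ d × Distance i u v)) ×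
    (∃[ u ] ∃[ v ] Distance d u v)

  -- A CAM has size m = suc k; the indices 1, …, m are shifted to Fin (suc k),
  -- so V₁(u) is cell zero.
  record CollapsedPartition {k : ℕ} (C : Fin (suc k) → Fin (suc k) → ℕ)
                            (u : Fin n) : Set where
    field
      cell      : Fin (suc k) → Subset n
      nonempty  : ∀ i → Nonempty (cell i)
      covers    : ∀ y → ∃[ i ] y ∈ cell i
      disjoint  : ∀ {i j y} → y ∈ cell i → y ∈ cell j → i ≡ j
      base      : cell zero ≡ ⁅ u ⁆
      collapsed : ∀ i j {y} → y ∈ cell j → ∣ neighbours y ∩ cell i ∣ ≡ C i j

  record HighlyRegular : Set where
    field
      k          : ℕ
      2≤m        : 2 ≤ suc k
      m<n⊎m=n=2  : suc k < n ⊎ (suc k ≡ n × n ≡ 2)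
      C          : Fin (suc k) → Fin (suc k) → ℕ
      partitions : ∀ u → CollapsedPartition C u

  D : ℕ → Fin n → Subset n
  D i u = subset (distance? i u)

  -- D⁻ i u is D_{i-1}(u), with D_{-1}(u) empty.
  D⁻ : ℕ → Fin n → Subset n
  D⁻ zero    u = ⊥
  D⁻ (suc i) u = D i u

  record DistanceRegular : Set where
    field
      connected : Connected
      below : ∀ i {u v u′ v′} → Distance i u v → Distance i u′ v′ →
              ∣ D 1 v ∩ D⁻ i u ∣ ≡ ∣ D 1 v′ ∩ D⁻ i u′ ∣
      level : ∀ i {u v u′ v′} → Distance i u v → Distance i u′ v′ →
              ∣ D 1 v ∩ D i u ∣ ≡ ∣ D 1 v′ ∩ D i u′ ∣
      above : ∀ i {u v u′ v′} → Distance i u v → Distance i u′ v′ →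
              ∣ D 1 v ∩ D (suc i) u ∣ ≡ ∣ D 1 v′ ∩ D (suc i) u′ ∣

{-# OPTIONS --safe #-}

-- Each CAM entry c_{i,j} is nonzero exactly when cells i and j are joined by
-- edges, so the CAM determines which cells are within distance t of the base
-- vertex; hence every vertex u has some w with d(u,w) ≥ 3. Such a w is a common
-- non-neighbour of u and any neighbour of u, which gives diameter 2 for the
-- complement.  Counting edges between cells gives |V_j| c_{i,j} = |V_i| c_{j,i};
-- as Γ is connected, the cell sizes are then determined by the CAM, so the same
-- partitions serve the complement, with entries |V_i| − c_{i,j} − δ_{i,j}.
-- Finally let u, a, b, … be a geodesic of length ≥ 3 ending in v.  In the
-- complement, b and v are both at distance 1 from u and the second sphere around
-- u is N_Γ(u); it lies inside the neighbourhood of v, but a ∈ N_Γ(u) is missing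
-- from that of b.  So the number of neighbours in the next sphere is not constant.
module Submission where

open import Defs
import Algebra.Properties.Semiring.Sum
open import Data.Bool using (Bool; true; false; _∧_)
open import Data.Fin using (Fin; zero; suc)
open import Data.Fin.Properties using (_≟_)
open import Data.Fin.Subset using (Subset; _∈_; _∉_; _∩_; _⊂_; ⁅_⁆; ∣_∣; Nonempty)
open import Data.Fin.Subset.Properties using (nonempty?; Empty-unique; ∣⊥∣≡0; ∣⁅x⁆∣≡1; x∈⁅x⁆; x∈⁅y⁆⇒x≡y; x∈p∩q⁺; x∈p∩q⁻; x∈p⇒∣p-x∣<∣p∣; p⊂q⇒∣p∣<∣q∣; ⊆-antisym)
open import Data.Nat using (ℕ; zero; suc; _+_; _*_; _∸_; _≤_; _<_; z≤n; s≤s; ≢-nonZero)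
open import Data.Nat.Properties using (+-*-semiring; *-identityˡ; *-distribʳ-+; *-comm; *-assoc; *-cancelʳ-≡; m+n∸n≡m; m<n⇒n≢0; <-irrefl; ≤-refl; n≤1+n; ≤-trans)
open import Data.Product using (_×_; _,_; proj₁; proj₂; ∃-syntax)
open import Data.Vec using ([]; _∷_; lookup)
open import Data.Vec.Properties using (lookup∘tabulate; lookup-zipWith; []=⇒lookup; lookup⇒[]=)
open import Function using (_∘_; mk⇔)
open import Relation.Binary.PropositionalEquality using (_≡_; _≢_; refl; sym; trans; cong; cong₂; subst; module ≡-Reasoning)
open import Relation.Nullary using (¬_; Dec; yes; no; does; contradiction)
open import Relation.Nullary.Decidable using (dec-true; does-⇔; decidable-stable)
import Relation.Unary as U

open Algebra.Properties.Semiring.Sum +-*-semiring using (sum; sum-cong-≗; ∑-comm; ∑-distrib-+; *-distribˡ-sum; *-distribʳ-sum)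
open ≡-Reasoning

private
  variable
    n : ℕ

-- Subsets, indicator sums and cardinalities.

does⇒ : {A : Set} (a? : Dec A) → does a? ≡ true → A
does⇒ (yes a) _ = a

module _ {P : Fin n → Set} (P? : U.Decidable P) where

  ∈-subset⁺ : ∀ {x} → P x → x ∈ subset P?
  ∈-subset⁺ {x} px = lookup⇒[]= x _ (trans (lookup∘tabulate _ x) (dec-true (P? x) px))

  ∈-subset⁻ : ∀ {x} → x ∈ subset P? → P x
  ∈-subset⁻ {x} x∈ = does⇒ (P? x) (trans (sym (lookup∘tabulate _ x)) ([]=⇒lookup x∈))

x∈p⇒∣p∣≢0 : ∀ {x} {p : Subset n} → x ∈ p → ∣ p ∣ ≢ 0
x∈p⇒∣p∣≢0 x∈p = m<n⇒n≢0 (x∈p⇒∣p-x∣<∣p∣ x∈p)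

∣p∣≢0⇒Nonempty : (p : Subset n) → ∣ p ∣ ≢ 0 → Nonempty p
∣p∣≢0⇒Nonempty {n} p ∣p∣≢0 = decidable-stable (nonempty? p) λ empty →
  ∣p∣≢0 (trans (cong ∣_∣ (Empty-unique empty)) (∣⊥∣≡0 n))

𝟙 : Bool → ℕ
𝟙 false = 0
𝟙 true  = 1

𝟙-∧ : ∀ a b → 𝟙 (a ∧ b) ≡ 𝟙 a * 𝟙 b
𝟙-∧ false b = refl
𝟙-∧ true  b = sym (*-identityˡ (𝟙 b))

∣p∣≡∑𝟙 : (p : Subset n) → ∣ p ∣ ≡ sum (λ x → 𝟙 (lookup p x))
∣p∣≡∑𝟙 []          = refl
∣p∣≡∑𝟙 (true  ∷ p) = cong suc (∣p∣≡∑𝟙 p)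
∣p∣≡∑𝟙 (false ∷ p) = ∣p∣≡∑𝟙 p

∣p∩q∣≡∑𝟙*𝟙 : (p q : Subset n) → ∣ p ∩ q ∣ ≡ sum (λ x → 𝟙 (lookup p x) * 𝟙 (lookup q x))
∣p∩q∣≡∑𝟙*𝟙 p q = trans (∣p∣≡∑𝟙 (p ∩ q)) (sum-cong-≗ λ x →
  trans (cong 𝟙 (lookup-zipWith _∧_ x p q)) (𝟙-∧ (lookup p x) (lookup q x)))

-- The hypothesis says that `a`, `b`, `c` partition the vertex set. Phrased with indicators, it can
-- be multiplied by the indicator of `p` and summed.
∣p∣-split : (a b c p : Subset n) →
  (∀ x → 𝟙 (lookup a x) + (𝟙 (lookup b x) + 𝟙 (lookup c x)) ≡ 1) →
  ∣ a ∩ p ∣ + (∣ b ∩ p ∣ + ∣ c ∩ p ∣) ≡ ∣ p ∣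
∣p∣-split a b c p one = begin
  ∣ a ∩ p ∣ + (∣ b ∩ p ∣ + ∣ c ∩ p ∣)
    ≡⟨ cong₂ _+_ (∣p∩q∣≡∑𝟙*𝟙 a p) (cong₂ _+_ (∣p∩q∣≡∑𝟙*𝟙 b p) (∣p∩q∣≡∑𝟙*𝟙 c p)) ⟩
  sum (f a) + (sum (f b) + sum (f c))
    ≡⟨ cong (sum (f a) +_) (∑-distrib-+ (f b) (f c)) ⟨
  sum (f a) + sum (λ x → f b x + f c x)
    ≡⟨ ∑-distrib-+ (f a) (λ x → f b x + f c x) ⟨
  sum (λ x → f a x + (f b x + f c x))
    ≡⟨ sum-cong-≗ pointwise ⟩
  sum (λ x → 𝟙 (lookup p x))
    ≡⟨ ∣p∣≡∑𝟙 p ⟨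
  ∣ p ∣ ∎
  where
  f : Subset _ → Fin _ → ℕ
  f q x = 𝟙 (lookup q x) * 𝟙 (lookup p x)

  pointwise : ∀ x → f a x + (f b x + f c x) ≡ 𝟙 (lookup p x)
  pointwise x = begin
    f a x + (f b x + f c x)
      ≡⟨ cong (f a x +_) (*-distribʳ-+ (𝟙 (lookup p x)) (𝟙 (lookup b x)) _) ⟨
    f a x + (𝟙 (lookup b x) + 𝟙 (lookup c x)) * 𝟙 (lookup p x)
      ≡⟨ *-distribʳ-+ (𝟙 (lookup p x)) (𝟙 (lookup a x)) _ ⟨
    (𝟙 (lookup a x) + (𝟙 (lookup b x) + 𝟙 (lookup c x))) * 𝟙 (lookup p x)
      ≡⟨ cong (_* 𝟙 (lookup p x)) (one x) ⟩
    1 * 𝟙 (lookup p x)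
      ≡⟨ *-identityˡ _ ⟩
    𝟙 (lookup p x) ∎

∣⁅y⁆∩p∣≡1 : ∀ {y} {p : Subset n} → y ∈ p → ∣ subset (y ≟_) ∩ p ∣ ≡ 1
∣⁅y⁆∩p∣≡1 {y = y} {p} y∈p = trans (cong ∣_∣ (⊆-antisym
  (λ x∈ → subst (_∈ ⁅ y ⁆) (∈-subset⁻ (y ≟_) (proj₁ (x∈p∩q⁻ _ p x∈))) (x∈⁅x⁆ y))
  (λ x∈ → subst (_∈ subset (y ≟_) ∩ p) (sym (x∈⁅y⁆⇒x≡y y x∈)) (x∈p∩q⁺ (∈-subset⁺ (y ≟_) refl , y∈p)))))
  (∣⁅x⁆∣≡1 y)

∣⁅y⁆∩p∣≡0 : ∀ {y} {p : Subset n} → y ∉ p → ∣ subset (y ≟_) ∩ p ∣ ≡ 0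
∣⁅y⁆∩p∣≡0 {n} {y} {p} y∉p = trans (cong ∣_∣ (Empty-unique λ (x , x∈) →
  let (x∈⁅y⁆ , x∈p) = x∈p∩q⁻ _ p x∈
  in y∉p (subst (_∈ p) (sym (∈-subset⁻ (y ≟_) x∈⁅y⁆)) x∈p)))
  (∣⊥∣≡0 n)

-- Counting edges in a graph and its complement.

module _ (Γ : Graph n) where
  open Graph Γ

  neighbours-split : ∀ y p →
    ∣ neighbours (complement Γ) y ∩ p ∣ + (∣ neighbours Γ y ∩ p ∣ + ∣ subset (y ≟_) ∩ p ∣) ≡ ∣ p ∣
  neighbours-split y p = ∣p∣-split (neighbours (complement Γ) y) (neighbours Γ y) (subset (y ≟_)) p λ x →
    trans (cong₂ _+_ (at (Graph.adj? (complement Γ) y) x) (cong₂ _+_ (at (adj? y) x) (at (y ≟_) x))) (one x)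
    where
    at : {P : Fin n → Set} (P? : U.Decidable P) (x : Fin n) → 𝟙 (lookup (subset P?) x) ≡ 𝟙 (does (P? x))
    at P? x = cong 𝟙 (lookup∘tabulate (does ∘ P?) x)

    one : ∀ x → 𝟙 (does (Graph.adj? (complement Γ) y x)) + (𝟙 (does (adj? y x)) + 𝟙 (does (y ≟ x))) ≡ 1
    -- The complement's `adj?` is built from these two decisions, so abstracting them evaluates all
    -- three indicators.
    one x with y ≟ x | adj? y x
    ... | yes refl | yes yy = contradiction yy irrefl
    ... | yes _    | no _   = refl
    ... | no _     | yes _  = refl
    ... | no _     | no _   = refl

  -- Both sides count the edges from `q` to `p`; the double sum is the form in which the order of
  -- summation can be exchanged.
  ∣q∣*c≡∑∑ : ∀ (p q : Subset n) {c} → (∀ {y} → y ∈ q → ∣ neighbours Γ y ∩ p ∣ ≡ c) →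
    ∣ q ∣ * c ≡ sum (λ y → sum (λ x → 𝟙 (lookup q y) * (𝟙 (does (adj? y x)) * 𝟙 (lookup p x))))
  ∣q∣*c≡∑∑ p q {c} reg = begin
    ∣ q ∣ * c
      ≡⟨ cong (_* c) (∣p∣≡∑𝟙 q) ⟩
    sum (λ y → 𝟙 (lookup q y)) * c
      ≡⟨ *-distribʳ-sum c (λ y → 𝟙 (lookup q y)) ⟩
    sum (λ y → 𝟙 (lookup q y) * c)
      ≡⟨ sum-cong-≗ weight ⟩
    sum (λ y → 𝟙 (lookup q y) * ∣ neighbours Γ y ∩ p ∣)
      ≡⟨ sum-cong-≗ expand ⟩
    sum (λ y → sum (λ x → 𝟙 (lookup q y) * (𝟙 (does (adj? y x)) * 𝟙 (lookup p x)))) ∎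
    where
    weight : ∀ y → 𝟙 (lookup q y) * c ≡ 𝟙 (lookup q y) * ∣ neighbours Γ y ∩ p ∣
    weight y with lookup q y in eq
    ... | false = refl
    ... | true  = cong (1 *_) (sym (reg (lookup⇒[]= y q eq)))

    expand : ∀ y → 𝟙 (lookup q y) * ∣ neighbours Γ y ∩ p ∣
                 ≡ sum (λ x → 𝟙 (lookup q y) * (𝟙 (does (adj? y x)) * 𝟙 (lookup p x)))
    expand y = trans
      (cong (𝟙 (lookup q y) *_) (trans (∣p∩q∣≡∑𝟙*𝟙 (neighbours Γ y) p) (sum-cong-≗ λ x →
        cong (λ b → 𝟙 b * 𝟙 (lookup p x)) (lookup∘tabulate (does ∘ adj? y) x))))
      (*-distribˡ-sum (𝟙 (lookup q y)) (λ x → 𝟙 (does (adj? y x)) * 𝟙 (lookup p x)))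

  edge-double-count : ∀ (p q : Subset n) {c c′} →
    (∀ {y} → y ∈ q → ∣ neighbours Γ y ∩ p ∣ ≡ c) →
    (∀ {x} → x ∈ p → ∣ neighbours Γ x ∩ q ∣ ≡ c′) →
    ∣ q ∣ * c ≡ ∣ p ∣ * c′
  edge-double-count p q {c} {c′} reg reg′ = begin
    ∣ q ∣ * c
      ≡⟨ ∣q∣*c≡∑∑ p q reg ⟩
    sum (λ y → sum (λ x → Q y * (E y x * P x)))
      ≡⟨ ∑-comm (λ y x → Q y * (E y x * P x)) ⟩
    sum (λ x → sum (λ y → Q y * (E y x * P x)))
      ≡⟨ sum-cong-≗ (λ x → sum-cong-≗ (λ y → swap x y)) ⟩
    sum (λ x → sum (λ y → P x * (E x y * Q y)))
      ≡⟨ ∣q∣*c≡∑∑ q p reg′ ⟨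
    ∣ p ∣ * c′ ∎
    where
    P Q : Fin n → ℕ
    P x = 𝟙 (lookup p x)
    Q y = 𝟙 (lookup q y)

    E : Fin n → Fin n → ℕ
    E y x = 𝟙 (does (adj? y x))

    swap : ∀ x y → Q y * (E y x * P x) ≡ P x * (E x y * Q y)
    swap x y = begin
      Q y * (E y x * P x) ≡⟨ *-comm (Q y) _ ⟩
      E y x * P x * Q y   ≡⟨ cong (_* Q y) (*-comm (E y x) (P x)) ⟩
      P x * E y x * Q y   ≡⟨ *-assoc (P x) (E y x) (Q y) ⟩
      P x * (E y x * Q y) ≡⟨ cong (λ b → P x * (𝟙 b * Q y)) (does-⇔ (mk⇔ symm symm) (adj? y x) (adj? x y)) ⟩
      P x * (E x y * Q y) ∎

  -- What the CAM determines: walks to the base vertex and cell sizes.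

  module _ {k : ℕ} {C : Fin (suc k) → Fin (suc k) → ℕ} where

    module _ {u : Fin n} (P : CollapsedPartition Γ C u) where
      open CollapsedPartition P

      cell-double-count : ∀ i j → ∣ cell j ∣ * C i j ≡ ∣ cell i ∣ * C j i
      cell-double-count i j = edge-double-count (cell i) (cell j) (collapsed i j) (collapsed j i)

      -- With its converse `C≢0⇒edge`, this carries an edge from the partition around one vertex to
      -- the partition around another, since both share `C`.
      edge⇒C≢0 : ∀ {i j x y} → x ∈ cell i → y ∈ cell j → Adj y x → C i j ≢ 0
      edge⇒C≢0 {i} {j} x∈ y∈ yx C≡0 =
        x∈p⇒∣p∣≢0 (x∈p∩q⁺ (∈-subset⁺ (adj? _) yx , x∈)) (trans (collapsed i j y∈) C≡0)

      C≢0⇒edge : ∀ {i j y} → y ∈ cell j → C i j ≢ 0 → ∃[ x ] (x ∈ cell i × Adj y x)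
      C≢0⇒edge {i} {j} {y} y∈ C≢0 =
        let (x , x∈) = ∣p∣≢0⇒Nonempty (neighbours Γ y ∩ cell i) (C≢0 ∘ trans (sym (collapsed i j y∈)))
            (x∈N , x∈cell) = x∈p∩q⁻ _ (cell i) x∈
        in x , x∈cell , ∈-subset⁻ (adj? y) x∈N

      base-∈ : u ∈ cell zero
      base-∈ = subst (u ∈_) (sym base) (x∈⁅x⁆ u)

      ∈-base : ∀ {y} → y ∈ cell zero → y ≡ u
      ∈-base = x∈⁅y⁆⇒x≡y u ∘ subst (_ ∈_) base

    module _ {u u′ : Fin n} (P : CollapsedPartition Γ C u) (P′ : CollapsedPartition Γ C u′) where
      private
        module P  = CollapsedPartition P
        module P′ = CollapsedPartition P′

      -- The walk is copied edge by edge through cells with the same indices. It ends in cell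
      -- `zero`, which is a singleton, so the copy ends exactly at `u′`.
      walk-transport : ∀ t {j y y′} → y ∈ P.cell j → y′ ∈ P′.cell j → Walk Γ t y u → Walk Γ t y′ u′
      walk-transport zero y∈ y′∈ refl =
        ∈-base P′ (subst (λ i → _ ∈ P′.cell i) (P.disjoint y∈ (base-∈ P)) y′∈)
      walk-transport (suc t) y∈ y′∈ (w , yw , walk) =
        let (i , w∈) = P.covers w
            (w′ , w′∈ , y′w′) = C≢0⇒edge P′ y′∈ (edge⇒C≢0 P w∈ y∈ yw)
        in w′ , y′w′ , walk-transport t w∈ w′∈ walk

      -- Double counting between cells `i` and `j` holds in both partitions with the same entries,
      -- and the edge makes `C i j` cancellable.
      size-step : ∀ {i j x y} → x ∈ P.cell i → y ∈ P.cell j → Adj x y →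
        ∣ P.cell i ∣ ≡ ∣ P′.cell i ∣ → ∣ P.cell j ∣ ≡ ∣ P′.cell j ∣
      size-step {i} {j} x∈ y∈ xy eq = *-cancelʳ-≡ _ _ (C i j) {{≢-nonZero (edge⇒C≢0 P x∈ y∈ (symm xy))}} (begin
        ∣ P.cell j ∣ * C i j  ≡⟨ cell-double-count P i j ⟩
        ∣ P.cell i ∣ * C j i  ≡⟨ cong (_* C j i) eq ⟩
        ∣ P′.cell i ∣ * C j i ≡⟨ cell-double-count P′ i j ⟨
        ∣ P′.cell j ∣ * C i j ∎)

      size-walk : ∀ t {i j x y} → x ∈ P.cell i → y ∈ P.cell j → Walk Γ t x y →
        ∣ P.cell i ∣ ≡ ∣ P′.cell i ∣ → ∣ P.cell j ∣ ≡ ∣ P′.cell j ∣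
      size-walk zero x∈ y∈ refl eq = subst (λ l → ∣ P.cell l ∣ ≡ ∣ P′.cell l ∣) (P.disjoint x∈ y∈) eq
      size-walk (suc t) x∈ y∈ (w , xw , walk) eq =
        let (_ , w∈) = P.covers w
        in size-walk t w∈ y∈ walk (size-step x∈ w∈ xw eq)

      cell-size-unique : Connected Γ → ∀ j → ∣ P.cell j ∣ ≡ ∣ P′.cell j ∣
      cell-size-unique conn j =
        let (y , y∈) = P.nonempty j
            (t , walk) = conn u y
        -- The propagation starts at the base cells, which both have size 1.
        in size-walk t (base-∈ P) y∈ walk (begin
          ∣ P.cell zero ∣  ≡⟨ cong ∣_∣ P.base ⟩
          ∣ ⁅ u ⁆ ∣        ≡⟨ ∣⁅x⁆∣≡1 u ⟩
          1                ≡⟨ ∣⁅x⁆∣≡1 u′ ⟨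
          ∣ ⁅ u′ ⁆ ∣       ≡⟨ cong ∣_∣ P′.base ⟨
          ∣ P′.cell zero ∣ ∎)

  -- High regularity of the complement.

  ∣⁅y⁆∩cell∣ : ∀ {k u} {C : Fin (suc k) → Fin (suc k) → ℕ} (P : CollapsedPartition Γ C u) →
    let open CollapsedPartition P in
    ∀ i j {y} → y ∈ cell j → ∣ subset (y ≟_) ∩ cell i ∣ ≡ 𝟙 (does (i ≟ j))
  ∣⁅y⁆∩cell∣ P i j y∈ with i ≟ j
  ... | yes refl = ∣⁅y⁆∩p∣≡1 y∈
  ... | no i≢j   = ∣⁅y⁆∩p∣≡0 λ y∈i → i≢j (CollapsedPartition.disjoint P y∈i y∈)

  complement-highlyRegular : Fin n → Connected Γ → HighlyRegular Γ → HighlyRegular (complement Γ)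
  complement-highlyRegular o conn hr = record
    { k          = k
    ; 2≤m        = 2≤m
    ; m<n⊎m=n=2  = m<n⊎m=n=2
    ; C          = C̄
    ; partitions = λ u → record
      { cell      = cell u
      ; nonempty  = nonempty u
      ; covers    = covers u
      ; disjoint  = disjoint u
      ; base      = base u
      ; collapsed = collapsed̄ u
      }
    }
    where
    open HighlyRegular hr
    module _ (u : Fin n) where
      open CollapsedPartition (partitions u) public

    -- A CAM may not depend on `u`, so the sizes are read off at the fixed vertex `o`.
    C̄ : Fin (suc k) → Fin (suc k) → ℕ
    C̄ i j = ∣ cell o i ∣ ∸ (C i j + 𝟙 (does (i ≟ j)))

    collapsed̄ : ∀ u i j {y} → y ∈ cell u j → ∣ neighbours (complement Γ) y ∩ cell u i ∣ ≡ C̄ i j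
    collapsed̄ u i j {y} y∈ = begin
      -- Truncated subtraction loses nothing here: by `total`, the cell size is a sum containing
      -- what is subtracted.
      N̄                                                ≡⟨ m+n∸n≡m N̄ (C i j + δ) ⟨
      N̄ + (C i j + δ) ∸ (C i j + δ)                    ≡⟨ cong (_∸ (C i j + δ)) total ⟩
      ∣ cell u i ∣ ∸ (C i j + δ)                       ≡⟨ cong (_∸ (C i j + δ)) (cell-size-unique (partitions u) (partitions o) conn i) ⟩
      C̄ i j                                            ∎
      where
      N̄ = ∣ neighbours (complement Γ) y ∩ cell u i ∣
      δ = 𝟙 (does (i ≟ j))

      total : N̄ + (C i j + δ) ≡ ∣ cell u i ∣
      total = trans
        (cong (N̄ +_) (sym (cong₂ _+_ (collapsed u i j y∈) (∣⁅y⁆∩cell∣ (partitions u) i j y∈))))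
        (neighbours-split y (cell u i))

  -- Distances in the complement.

  farthest : HighlyRegular Γ → ∀ {d v₀ u₀} → Distance Γ d v₀ u₀ →
    ∀ u → ∃[ w ] (∀ {t} → t < d → ¬ Walk Γ t w u)
  farthest hr {d} {v₀} {u₀} (_ , shortest) u =
    -- Any `w` in the cell around `u` with the index of `v₀` will do: a short walk from `w` to `u`
    -- would transport to one from `v₀` to `u₀`.
    let (j , v₀∈) = covers₀ v₀
        (w , w∈) = CollapsedPartition.nonempty (partitions u) j
    in w , λ t<d walk → shortest t<d (walk-transport (partitions u) (partitions u₀) _ w∈ v₀∈ walk)
    where
    open HighlyRegular hr
    covers₀ = CollapsedPartition.covers (partitions u₀)

  complement-distance1⁺ : ∀ {u v} → u ≢ v → ¬ Adj u v → Distance (complement Γ) 1 u v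
  complement-distance1⁺ {u} {v} u≢v ¬uv = (v , (u≢v , ¬uv) , refl) , shortest
    where
    shortest : ∀ {j} → j < 1 → ¬ Walk (complement Γ) j u v
    shortest {zero}  _        = u≢v
    shortest {suc _} (s≤s ())

  complement-distance1⁻ : ∀ {u v} → Distance (complement Γ) 1 u v → u ≢ v × ¬ Adj u v
  complement-distance1⁻ ((_ , ūv , refl) , _) = ūv

  complement-distance2⁻ : ∀ {u v} → Distance (complement Γ) 2 u v → Adj u v
  complement-distance2⁻ {u} {v} (_ , shortest) = decidable-stable (adj? u v) λ ¬uv →
    shortest (s≤s (s≤s z≤n)) (v , (shortest (s≤s z≤n) , ¬uv) , refl)

  module _ (far : ∀ u → ∃[ w ] (∀ {t} → t < 3 → ¬ Walk Γ t w u)) where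

    complement-distance2⁺ : ∀ {u v} → Adj u v → Distance (complement Γ) 2 u v
    complement-distance2⁺ {u} {v} uv =
      let (w , no-walk) = far u
          w≢u = no-walk (s≤s z≤n)
          ¬wu = λ wu → no-walk (s≤s (s≤s z≤n)) (u , wu , refl)
          w≢v = λ w≡v → ¬wu (subst (λ z → Adj z u) (sym w≡v) (symm uv))
          -- An edge from `w` to `v` would complete the walk `w`, `v`, `u` of length 2.
          ¬wv = λ wv → no-walk (s≤s (s≤s (s≤s z≤n))) (v , wv , u , symm uv , refl)
      in (w , ((w≢u ∘ sym) , (¬wu ∘ symm)) , v , (w≢v , ¬wv) , refl) , shortest
      where
      shortest : ∀ {j} → j < 2 → ¬ Walk (complement Γ) j u v
      shortest {zero}        _ refl                   = irrefl uv
      shortest {suc zero}    _ (_ , (_ , ¬uv) , refl) = ¬uv uv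
      shortest {suc (suc _)} (s≤s (s≤s ()))

    complement-diameter : ∀ {u v} → Adj u v → HasDiameter (complement Γ) 2
    complement-diameter {u} {v} uv = bounded , u , v , complement-distance2⁺ uv
      where
      bounded : ∀ x y → ∃[ i ] (i ≤ 2 × Distance (complement Γ) i x y)
      bounded x y with x ≟ y | adj? x y
      ... | yes x≡y | _       = 0 , z≤n , x≡y , λ ()
      ... | no _    | yes xy  = 2 , ≤-refl , complement-distance2⁺ xy
      ... | no x≢y  | no ¬xy  = 1 , s≤s z≤n , complement-distance1⁺ x≢y ¬xy

    complement-¬distanceRegular : ∀ {e u v} → Distance Γ (3 + e) u v → ¬ DistanceRegular (complement Γ)
    complement-¬distanceRegular {e} {u} {v} ((a , ua , b , ab , c , bc , walk) , shortest) dr =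
      -- Both `b` and `v` are at complement distance 1 from `u`, so `above` forces equal counts,
      -- against the strict inclusion.
      <-irrefl (DistanceRegular.above dr 1 (complement-distance1⁺ u≢b ¬ub) (complement-distance1⁺ u≢v ¬uv))
               (p⊂q⇒∣p∣<∣q∣ sphere-⊂)
      where
      Δ = complement Γ

      u≢b : u ≢ b
      -- If `b` were `u`, the tail of the geodesic would join `u` to `v` in `1 + e` steps; an edge
      -- from `u` to `b` would do it in `2 + e`.
      u≢b refl = shortest (s≤s (n≤1+n _)) (c , bc , walk)

      ¬ub : ¬ Adj u b
      ¬ub ub = shortest ≤-refl (b , ub , c , bc , walk)

      u≢v : u ≢ v
      u≢v = shortest (s≤s z≤n)

      ¬uv : ¬ Adj u v
      ¬uv uv = shortest (s≤s (s≤s z≤n)) (v , uv , refl)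

      ∉N[v] : ∀ {x} → Adj u x → v ≢ x × ¬ Adj v x
      ∉N[v] {x} ux = (λ { refl → ¬uv ux }) ,
        λ vx → shortest (s≤s (s≤s (s≤s z≤n))) (x , ux , v , symm vx , refl)

      D1v : ∀ {x} → Adj u x → x ∈ D Δ 1 v
      D1v ux = let (v≢x , ¬vx) = ∉N[v] ux in ∈-subset⁺ (distance? Δ 1 v) (complement-distance1⁺ v≢x ¬vx)

      sphere-⊂ : (D Δ 1 b ∩ D Δ 2 u) ⊂ (D Δ 1 v ∩ D Δ 2 u)
      sphere-⊂ =
        -- Elements of `D Δ 2 u` are neighbours of `u` in `Γ`, hence at complement distance 1 from
        -- `v` by `∉N[v]`.
        (λ x∈ → let x∈D2 = proj₂ (x∈p∩q⁻ (D Δ 1 b) (D Δ 2 u) x∈) in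
          x∈p∩q⁺ (D1v (complement-distance2⁻ (∈-subset⁻ (distance? Δ 2 u) x∈D2)) , x∈D2)) ,
        -- Strictness comes from `a`, which is adjacent to `b` in `Γ`.
        a , x∈p∩q⁺ (D1v ua , ∈-subset⁺ (distance? Δ 2 u) (complement-distance2⁺ ua)) ,
        λ a∈ → proj₂ (complement-distance1⁻ (∈-subset⁻ (distance? Δ 1 b) (proj₁ (x∈p∩q⁻ (D Δ 1 b) (D Δ 2 u) a∈)))) (symm ab)

theorem4p1 : (n : ℕ) (Γ : Graph n) → HighlyRegular Γ → (d : ℕ) → HasDiameter Γ d → 3 ≤ d → HighlyRegular (complement Γ) × HasDiameter (complement Γ) 2 × ¬ DistanceRegular (complement Γ)
theorem4p1 n Γ hr (suc (suc (suc e))) (bounded , u , v , dist@((_ , ua , _) , _)) (s≤s (s≤s (s≤s z≤n))) =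
  -- The pair realising the diameter supplies the reference vertex `u`, the edge `ua` that becomes a
  -- pair at distance 2, and the geodesic.
  complement-highlyRegular Γ u (λ x y → let (i , _ , walk , _) = bounded x y in i , walk) hr ,
  complement-diameter Γ far ua ,
  complement-¬distanceRegular Γ far dist
  where
  far : ∀ x → ∃[ w ] (∀ {t} → t < 3 → ¬ Walk Γ t w x)
  far x =
    let (w , no-walk) = farthest Γ hr dist x
    in w , λ t<3 → no-walk (≤-trans t<3 (s≤s (s≤s (s≤s z≤n))))
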